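{- The variety $\mathbf{K}_2$ is not locally finite; in fact its free algebra on one generator is infinite.
   Context: A pseudocomplemented de Morgan algebra is $(L;\wedge,\vee,{}^\ast,{}^\prime,0,1)$ with bounded distributive lattice reduct, pseudocomplement ${}^\ast$ and de Morgan involution ${}^\prime$. With $x^{0(\prime\ast)}=x$, $x^{(k+1)(\prime\ast)}=((x^{k(\prime\ast)})')^\ast$, $\mathbf{K}_2$ is the variety of such algebras satisfying $x\wedge x^{\prime\ast\prime}\le y\vee y^\ast$ (regularity), $x\wedge x'\le y\vee y'$ (Kleene), and $(x\wedge x^{\prime\ast})^{2(\prime\ast)}=(x\wedge x^{\prime\ast})^{3(\prime\ast)}$ (range $2$). -}

module Defs where

open import Algebra.Core using (Op₁; Op₂)
open import Algebra.Lattice.Structures using (IsDistributiveLattice)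
open import Algebra.Lattice.Structures.Biased using (isDistributiveLatticeʳʲᵐ)
open import Data.Fin.Base using (Fin)
open import Data.Fin.Properties using (ℕ→Fin-notInjective)
open import Data.Nat.Base using (ℕ)
open import Data.Nat.GeneralisedArithmetic using (fold)
open import Data.Product.Base using (Σ; ∃; _,_; proj₁)
open import Function.Base using (_∘_)
open import Function.Bundles using (Surjection; Injection)
open import Level using (Level; _⊔_) renaming (suc to lsuc)
open import Relation.Binary.Bundles using (Setoid)
open import Relation.Binary.Core using (Rel)
open import Relation.Binary.Definitions using (Minimum; Maximum)
import Relation.Binary.Construct.NaturalOrder.Left as NaturalOrder
import Relation.Binary.Construct.On as On
import Relation.Binary.PropositionalEquality as ≡
open import Relation.Nullary.Negation.Core using (¬_)
open import Relation.Unary using (Pred)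

private
  variable
    a c d ℓ ℓ′ x : Level

record RawAlgebra c ℓ : Set (lsuc (c ⊔ ℓ)) where
  infix  4 _≈_
  infixr 6 _∨_
  infixr 7 _∧_
  infixl 8 _∗ _′
  field
    Carrier : Set c
    _≈_     : Rel Carrier ℓ
    _∧_ _∨_ : Op₂ Carrier
    _∗ _′   : Op₁ Carrier
    0# 1#   : Carrier

  -- x ≤ y  is  x ≈ x ∧ y
  open NaturalOrder _≈_ _∧_ public using (_≤_)

  _^_⟨′∗⟩ : Carrier → ℕ → Carrier
  y ^ k ⟨′∗⟩ = fold y (λ z → z ′ ∗) k

-- The laws 0′ ≈ 1, 1′ ≈ 0 and (y ∨ z)′ ≈ y′ ∧ z′, and the fact that ∗ respects
-- ≈, are consequences of the fields below.
record IsPseudocomplementedDeMorgan (A : RawAlgebra c ℓ) : Set (c ⊔ ℓ) where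
  open RawAlgebra A
  field
    isDistributiveLattice : IsDistributiveLattice _≈_ _∨_ _∧_
    0-minimum  : Minimum _≤_ 0#
    1-maximum  : Maximum _≤_ 1#
    ∗-disjoint : ∀ y → y ∧ y ∗ ≈ 0#
    ∗-greatest : ∀ y z → y ∧ z ≈ 0# → z ≤ y ∗
    ′-cong       : ∀ {y z} → y ≈ z → y ′ ≈ z ′
    ′-involutive : ∀ y → y ′ ′ ≈ y
    ′-deMorgan   : ∀ y z → (y ∧ z) ′ ≈ y ′ ∨ z ′

  open IsDistributiveLattice isDistributiveLattice public

record IsK₂ (A : RawAlgebra c ℓ) : Set (c ⊔ ℓ) where
  open RawAlgebra A
  field
    isPseudocomplementedDeMorgan : IsPseudocomplementedDeMorgan A
    regular : ∀ y z → y ∧ y ′ ∗ ′ ≤ z ∨ z ∗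
    kleene  : ∀ y z → y ∧ y ′ ≤ z ∨ z ′
    range-2 : ∀ y → (y ∧ y ′ ∗) ^ 2 ⟨′∗⟩ ≈ (y ∧ y ′ ∗) ^ 3 ⟨′∗⟩

  open IsPseudocomplementedDeMorgan isPseudocomplementedDeMorgan public

record K₂ c ℓ : Set (lsuc (c ⊔ ℓ)) where
  field
    raw  : RawAlgebra c ℓ
    isK₂ : IsK₂ raw

  open RawAlgebra raw public
  open IsK₂ isK₂ public

  setoid : Setoid c ℓ
  setoid = record { isEquivalence = isEquivalence }

-- The subuniverse generated by the family g.
module _ (A : RawAlgebra c ℓ) {I : Set x} (g : I → RawAlgebra.Carrier A) where
  open RawAlgebra A

  data Sg : Pred Carrier (c ⊔ ℓ ⊔ x) where
    gen  : ∀ i → Sg (g i)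
    resp : ∀ {y z} → y ≈ z → Sg y → Sg z
    ∧-closed : ∀ {y z} → Sg y → Sg z → Sg (y ∧ z)
    ∨-closed : ∀ {y z} → Sg y → Sg z → Sg (y ∨ z)
    ∗-closed : ∀ {y} → Sg y → Sg (y ∗)
    ′-closed : ∀ {y} → Sg y → Sg (y ′)
    0-closed : Sg 0#
    1-closed : Sg 1#

SgSetoid : (A : K₂ c ℓ) {I : Set x} (g : I → K₂.Carrier A) → Setoid (c ⊔ ℓ ⊔ x) ℓ
SgSetoid A g = On.setoid {B = ∃ (Sg (K₂.raw A) g)} (K₂.setoid A) proj₁

-- Enumerability by some Fin n, possibly with repetitions: constructively the
-- weaker notion of finiteness, so that its negation is the stronger one.
Finite : Setoid a ℓ → Set (a ⊔ ℓ)
Finite S = Σ ℕ λ n → Surjection (≡.setoid (Fin n)) S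

Infinite : Setoid a ℓ → Set (a ⊔ ℓ)
Infinite S = Injection (≡.setoid ℕ) S

infinite⇒¬finite : (S : Setoid a ℓ) → Infinite S → ¬ Finite S
infinite⇒¬finite S inj (n , surj) = ℕ→Fin-notInjective (to⁻ ∘ I.to) λ {i} {j} eq →
  I.injective (trans (sym (to∘to⁻ (I.to i))) (trans (cong eq) (to∘to⁻ (I.to j))))
  where
  open Setoid S using (sym; trans)
  open Surjection surj using (to⁻; to∘to⁻; cong)
  module I = Injection inj

LocallyFinite-K₂ : ∀ c ℓ → Set (lsuc (c ⊔ ℓ))
LocallyFinite-K₂ c ℓ =
  (A : K₂ c ℓ) (n : ℕ) (g : Fin n → K₂.Carrier A) → Finite (SgSetoid A g)

module FreeAlgebra (X : Set x) where

  infixr 6 _∨_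
  infixr 7 _∧_
  infixl 8 _∗ _′

  data Term : Set x where
    var     : X → Term
    _∧_ _∨_ : Term → Term → Term
    _∗ _′   : Term → Term
    0# 1#   : Term

  infix 4 _≈_

  -- The least congruence making the quotient a member of K₂.  Pseudocomplements
  -- are imposed by a Horn clause (∗-greatest) and not by equations; the result
  -- is still the free algebra, as its universal property below confirms.
  data _≈_ : Rel Term x where
    refl  : ∀ {s} → s ≈ s
    sym   : ∀ {s t} → s ≈ t → t ≈ s
    trans : ∀ {s t u} → s ≈ t → t ≈ u → s ≈ u

    ∧-cong : ∀ {s t u v} → s ≈ t → u ≈ v → s ∧ u ≈ t ∧ v
    ∨-cong : ∀ {s t u v} → s ≈ t → u ≈ v → s ∨ u ≈ t ∨ v
    ∗-cong : ∀ {s t} → s ≈ t → s ∗ ≈ t ∗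
    ′-cong : ∀ {s t} → s ≈ t → s ′ ≈ t ′

    ∧-comm       : ∀ s t → s ∧ t ≈ t ∧ s
    ∧-assoc      : ∀ s t u → (s ∧ t) ∧ u ≈ s ∧ (t ∧ u)
    ∨-comm       : ∀ s t → s ∨ t ≈ t ∨ s
    ∨-assoc      : ∀ s t u → (s ∨ t) ∨ u ≈ s ∨ (t ∨ u)
    ∨-absorbs-∧  : ∀ s t → s ∨ (s ∧ t) ≈ s
    ∧-absorbs-∨  : ∀ s t → s ∧ (s ∨ t) ≈ s
    ∨-distribʳ-∧ : ∀ s t u → (t ∧ u) ∨ s ≈ (t ∨ s) ∧ (u ∨ s)
    0-minimum    : ∀ s → 0# ≈ 0# ∧ s
    1-maximum    : ∀ s → s ≈ s ∧ 1#

    ∗-disjoint : ∀ s → s ∧ s ∗ ≈ 0#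
    ∗-greatest : ∀ s t → s ∧ t ≈ 0# → t ≈ t ∧ s ∗

    ′-involutive : ∀ s → s ′ ′ ≈ s
    ′-deMorgan   : ∀ s t → (s ∧ t) ′ ≈ s ′ ∨ t ′

    regular : ∀ s t → s ∧ s ′ ∗ ′ ≈ (s ∧ s ′ ∗ ′) ∧ (t ∨ t ∗)
    kleene  : ∀ s t → s ∧ s ′ ≈ (s ∧ s ′) ∧ (t ∨ t ′)
    range-2 : ∀ s → (s ∧ s ′ ∗) ′ ∗ ′ ∗ ≈ (s ∧ s ′ ∗) ′ ∗ ′ ∗ ′ ∗

  raw : RawAlgebra x x
  raw = record
    { Carrier = Term ; _≈_ = _≈_ ; _∧_ = _∧_ ; _∨_ = _∨_
    ; _∗ = _∗ ; _′ = _′ ; 0# = 0# ; 1# = 1# }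

  free : K₂ x x
  free = record
    { raw  = raw
    ; isK₂ = record
      { isPseudocomplementedDeMorgan = record
        { isDistributiveLattice = isDistributiveLatticeʳʲᵐ (record
          { isLattice = record
            { isEquivalence = record { refl = refl ; sym = sym ; trans = trans }
            ; ∨-comm = ∨-comm ; ∨-assoc = ∨-assoc ; ∨-cong = ∨-cong
            ; ∧-comm = ∧-comm ; ∧-assoc = ∧-assoc ; ∧-cong = ∧-cong
            ; absorptive = ∨-absorbs-∧ , ∧-absorbs-∨
            }
          ; ∨-distribʳ-∧ = ∨-distribʳ-∧
          })
        ; 0-minimum = 0-minimum ; 1-maximum = 1-maximum
        ; ∗-disjoint = ∗-disjoint ; ∗-greatest = ∗-greatest
        ; ′-cong = ′-cong ; ′-involutive = ′-involutive ; ′-deMorgan = ′-deMorgan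
        }
      ; regular = regular ; kleene = kleene ; range-2 = range-2
      }
    }

Free : Set x → K₂ x x
Free = FreeAlgebra.free

record IsHomomorphism (A : RawAlgebra c ℓ) (B : RawAlgebra d ℓ′)
                      (h : RawAlgebra.Carrier A → RawAlgebra.Carrier B)
                      : Set (c ⊔ ℓ ⊔ ℓ′) where
  private
    module A = RawAlgebra A
    module B = RawAlgebra B
  field
    cong   : ∀ {y z} → y A.≈ z → h y B.≈ h z
    ∧-homo : ∀ y z → h (y A.∧ z) B.≈ h y B.∧ h z
    ∨-homo : ∀ y z → h (y A.∨ z) B.≈ h y B.∨ h z
    ∗-homo : ∀ y → h (y A.∗) B.≈ h y B.∗
    ′-homo : ∀ y → h (y A.′) B.≈ h y B.′
    0-homo : h A.0# B.≈ B.0#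
    1-homo : h A.1# B.≈ B.1#

module _ (A : K₂ c ℓ) where
  open K₂ A

  private
    ≈⇒∗≤∗ : ∀ {y z} → y ≈ z → y ∗ ≤ z ∗
    ≈⇒∗≤∗ y≈z = ∗-greatest _ _ (trans (∧-cong (sym y≈z) refl) (∗-disjoint _))

  ∗-cong : ∀ {y z} → y ≈ z → y ∗ ≈ z ∗
  ∗-cong y≈z = trans (≈⇒∗≤∗ y≈z) (trans (∧-comm _ _) (sym (≈⇒∗≤∗ (sym y≈z))))

-- Universal property of Free X: existence and uniqueness of extensions.
module _ {X : Set x} (A : K₂ c ℓ) (ρ : X → K₂.Carrier A) where
  open K₂ A
  private
    module F = FreeAlgebra X

  ⟦_⟧ : F.Term → Carrier
  ⟦ F.var i ⟧ = ρ i
  ⟦ s F.∧ t ⟧ = ⟦ s ⟧ ∧ ⟦ t ⟧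
  ⟦ s F.∨ t ⟧ = ⟦ s ⟧ ∨ ⟦ t ⟧
  ⟦ s F.∗ ⟧   = ⟦ s ⟧ ∗
  ⟦ s F.′ ⟧   = ⟦ s ⟧ ′
  ⟦ F.0# ⟧    = 0#
  ⟦ F.1# ⟧    = 1#

  ⟦⟧-cong : ∀ {s t} → s F.≈ t → ⟦ s ⟧ ≈ ⟦ t ⟧
  ⟦⟧-cong F.refl                 = refl
  ⟦⟧-cong (F.sym p)              = sym (⟦⟧-cong p)
  ⟦⟧-cong (F.trans p q)          = trans (⟦⟧-cong p) (⟦⟧-cong q)
  ⟦⟧-cong (F.∧-cong p q)         = ∧-cong (⟦⟧-cong p) (⟦⟧-cong q)
  ⟦⟧-cong (F.∨-cong p q)         = ∨-cong (⟦⟧-cong p) (⟦⟧-cong q)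
  ⟦⟧-cong (F.∗-cong p)           = ∗-cong A (⟦⟧-cong p)
  ⟦⟧-cong (F.′-cong p)           = ′-cong (⟦⟧-cong p)
  ⟦⟧-cong (F.∧-comm s t)         = ∧-comm _ _
  ⟦⟧-cong (F.∧-assoc s t u)      = ∧-assoc _ _ _
  ⟦⟧-cong (F.∨-comm s t)         = ∨-comm _ _
  ⟦⟧-cong (F.∨-assoc s t u)      = ∨-assoc _ _ _
  ⟦⟧-cong (F.∨-absorbs-∧ s t)    = ∨-absorbs-∧ _ _
  ⟦⟧-cong (F.∧-absorbs-∨ s t)    = ∧-absorbs-∨ _ _
  ⟦⟧-cong (F.∨-distribʳ-∧ s t u) = ∨-distribʳ-∧ _ _ _
  ⟦⟧-cong (F.0-minimum s)        = 0-minimum _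
  ⟦⟧-cong (F.1-maximum s)        = 1-maximum _
  ⟦⟧-cong (F.∗-disjoint s)       = ∗-disjoint _
  ⟦⟧-cong (F.∗-greatest s t p)   = ∗-greatest _ _ (⟦⟧-cong p)
  ⟦⟧-cong (F.′-involutive s)     = ′-involutive _
  ⟦⟧-cong (F.′-deMorgan s t)     = ′-deMorgan _ _
  ⟦⟧-cong (F.regular s t)        = regular _ _
  ⟦⟧-cong (F.kleene s t)         = kleene _ _
  ⟦⟧-cong (F.range-2 s)          = range-2 _

  ⟦⟧-isHomomorphism : IsHomomorphism (K₂.raw (Free X)) raw ⟦_⟧
  ⟦⟧-isHomomorphism = record
    { cong = ⟦⟧-cong
    ; ∧-homo = λ _ _ → refl ; ∨-homo = λ _ _ → refl
    ; ∗-homo = λ _ → refl ; ′-homo = λ _ → refl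
    ; 0-homo = refl ; 1-homo = refl
    }

  ⟦⟧-unique : ∀ h → IsHomomorphism (K₂.raw (Free X)) raw h →
              (∀ i → h (F.var i) ≈ ρ i) → ∀ t → h t ≈ ⟦ t ⟧
  ⟦⟧-unique h h-hom h-var = go
    where
    open IsHomomorphism h-hom
    go : ∀ t → h t ≈ ⟦ t ⟧
    go (F.var i) = h-var i
    go (s F.∧ t) = trans (∧-homo s t) (∧-cong (go s) (go t))
    go (s F.∨ t) = trans (∨-homo s t) (∨-cong (go s) (go t))
    go (s F.∗)   = trans (∗-homo s) (∗-cong A (go s))
    go (s F.′)   = trans (′-homo s) (′-cong (go s))
    go F.0#      = 0-homo
    go F.1#      = 1-homo

{-# OPTIONS --safe #-}

-- The dual space of a member of K₂ has only minimal and maximal points, which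
-- the involution matches up; so it amounts to a reflexive symmetric graph, and
-- the range condition holds as soon as any two vertices have a common
-- neighbour.  Take the complement of the path 1 — 2 — ⋯ — n and add a vertex 0
-- adjacent to everything.  As the only non-neighbours of k + 1 are k (if k ≠ 0)
-- and k + 2, all singletons {1}, {2}, …, {n} are obtained from {1} alone.
-- Letting n grow separates infinitely many terms in one variable.
module Submission where

open import Defs
import Algebra.Lattice.Properties.BooleanAlgebra as BooleanAlgebraProperties
open import Algebra.Lattice.Structures.Biased using (isDistributiveLatticeʳʲᵐ)
open import Data.Bool.Base using (Bool; true; false; T; not; _∧_; _∨_)
open import Data.Bool.Properties
  using (T?; T-∧; ∧-comm; ∧-assoc; ∧-identityʳ; ∧-inverseʳ; ∧-abs-∨; ∨-comm
        ; ∨-assoc; ∨-inverseʳ; ∨-abs-∧; ∨-distribʳ-∧; not-involutive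
        ; ∨-∧-booleanAlgebra)
open import Data.Empty using (⊥-elim)
open import Data.Fin.Base using (Fin; zero; toℕ; fromℕ<)
open import Data.Fin.Properties using (all?; toℕ-fromℕ<)
open import Data.Nat.Base using (ℕ; zero; suc; _+_; _≤_; _<_; z<s; s≤s)
open import Data.Nat.Properties
  using (_≟_; _<?_; 1+n≢n; m≤m+n; m≤n+m; m+n≤o⇒n≤o; suc-injective)
open import Data.Product.Base using (_×_; _,_; proj₂; ∃)
open import Data.Sum.Base using (_⊎_; inj₁; inj₂; [_,_]′)
open import Data.Unit.Base using (tt)
open import Function.Base using (_∘_; _on_; case_of_; const)
open import Function.Bundles using (_⇔_; mk⇔; Equivalence)
open import Level using (0ℓ)
open import Relation.Binary.Core using (Rel)
open import Relation.Binary.Definitions using (Decidable; Reflexive; Symmetric)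
open import Relation.Binary.PropositionalEquality
  using (_≡_; refl; sym; trans; cong; cong₂; subst)
open import Relation.Nullary.Decidable
  using (⌊_⌋; toWitness; fromWitness; decidable-stable
        ; _×-dec_; _⊎-dec_; ¬?; _→-dec_)
open import Relation.Nullary.Negation.Core using (¬_)

open BooleanAlgebraProperties ∨-∧-booleanAlgebra using (deMorgan₁)
open Equivalence using (to; from)

-- Truth of Booleans and the order on them.

T-≤ : ∀ {a b} → (T a → T b) → a ≡ a ∧ b
T-≤ {false}         _ = refl
T-≤ {true}  {true}  _ = refl
T-≤ {true}  {false} f = ⊥-elim (f tt)

T-ext : ∀ {a b} → (T a → T b) → (T b → T a) → a ≡ b
T-ext {a} {b} f g = trans (T-≤ f) (trans (∧-comm a b) (sym (T-≤ g)))

T-disjoint : ∀ {a b} → (T a → ¬ T b) → a ∧ b ≡ false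
T-disjoint {false}         _ = refl
T-disjoint {true}  {false} _ = refl
T-disjoint {true}  {true}  f = ⊥-elim (f tt tt)

T-not : ∀ {a} → T (not a) ⇔ (¬ T a)
T-not {false} = mk⇔ (λ _ ()) (const tt)
T-not {true}  = mk⇔ (λ ()) (λ f → f tt)

T-notnot : ∀ {a} → T (not (not a)) ⇔ T a
T-notnot {false} = mk⇔ (λ ()) (λ ())
T-notnot {true}  = mk⇔ _ _

-- The algebra of up-sets of a reflexive symmetric graph.

module ComplexAlgebra
  {n} (R : Rel (Fin n) 0ℓ) (R? : Decidable R)
  (R-refl : Reflexive R) (R-sym : Symmetric R)
  (R-diam : ∀ u w → ∃ λ v → R u v × R v w)
  where

  □ : (Fin n → Bool) → Fin n → Bool
  □ p w = ⌊ all? (λ v → R? w v →-dec T? (p v)) ⌋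

  □-spec : ∀ {p w} → T (□ p w) ⇔ (∀ v → R w v → T (p v))
  □-spec = mk⇔ toWitness fromWitness

  -- Every vertex is reached from `w` in two steps through a common neighbour, so two boxes at a
  -- single vertex quantify over the whole graph.
  □□⇒all : ∀ {p w} → (∀ v → R w v → T (□ p v)) → ∀ v → T (p v)
  □□⇒all {w = w} □□p v with R-diam w v
  ... | u , wRu , uRv = to □-spec (□□p u wRu) v uRv

  -- An up-set of the poset with a minimal point lo w and a maximal point hi w
  -- for every vertex w, and lo u below hi v iff u and v are adjacent.
  record Upset : Set where
    constructor mk
    field
      lo hi  : Fin n → Bool
      closed : ∀ {u v} → R u v → T (lo u) → T (hi v)
  open Upset public

  infix 4 _≈_
  -- Pointwise, so that neither function extensionality nor equality of the `closed` proofs is at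
  -- stake.
  record _≈_ (U V : Upset) : Set where
    constructor _,_
    field
      lo-≡ : ∀ w → lo U w ≡ lo V w
      hi-≡ : ∀ w → hi U w ≡ hi V w
  open _≈_ public

  raw : RawAlgebra 0ℓ 0ℓ
  raw = record
    { Carrier = Upset
    ; _≈_ = _≈_
    ; _∧_ = λ U V → mk (λ w → lo U w ∧ lo V w) (λ w → hi U w ∧ hi V w)
        λ {u} r p → let p₁ , p₂ = to (T-∧ {lo U u}) p in from T-∧ (closed U r p₁ , closed V r p₂)
    ; _∨_ = λ U V → mk (λ w → lo U w ∨ lo V w) (λ w → hi U w ∨ hi V w)
        λ r → T-∨-map (closed U r) (closed V r)
    -- The complement of the down-set generated by `U`: a `lo` point is kept iff no `hi` point above
    -- it lies in `U`.
    ; _∗ = λ U → mk (□ (not ∘ hi U)) (not ∘ hi U) λ r p → to □-spec p _ r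
    -- The complement of the image of `U` under the order-reversing swap of `lo w` and `hi w`.
    ; _′ = λ U → mk (not ∘ hi U) (not ∘ lo U)
        λ r p → from T-not (to T-not p ∘ closed U (R-sym r))
    ; 0# = mk (const false) (const false) λ _ ()
    ; 1# = mk (const true) (const true) λ _ _ → tt
    }
    where
    T-∨-map : ∀ {a b c d} → (T a → T c) → (T b → T d) → T (a ∨ b) → T (c ∨ d)
    T-∨-map {c = true}          _ _ _ = tt
    T-∨-map {true}  {c = false} f _ p = ⊥-elim (f p)
    T-∨-map {false} {c = false} _ g p = g p

  open RawAlgebra raw using (_∗; _′) renaming (_∧_ to _⊓_; _≤_ to _⊑_)

  lo≤hi : ∀ U {w} → T (lo U w) → T (hi U w)
  lo≤hi U = closed U R-refl

  ∗-greatest : ∀ U V → U ⊓ V ≈ RawAlgebra.0# raw → V ⊑ U ∗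
  ∗-greatest U V U⊓V≈0 =
    (λ w → T-≤ λ p → from □-spec λ v r → disjoint (closed V r p)) ,
    (λ w → T-≤ disjoint)
    where
    disjoint : ∀ {v} → T (hi V v) → T (not (hi U v))
    disjoint {v} q = from T-not λ p → subst T (hi-≡ U⊓V≈0 v) (from T-∧ (p , q))

  -- Up to double negations, `′ ∗` boxes the `lo` part and moves the old `lo` part to `hi`. So both
  -- components reduce to one claim: a second box on `p`, the `lo` part of `U ⊓ U ′ ∗`, changes
  -- nothing. As `p` already contains a box of `lo U`, boxing it once gives `□□⇒all` its two boxes.
  -- Hence the boxed `p` is everything or empty.
  range-2 : ∀ U → let V = U ⊓ U ′ ∗ in V ′ ∗ ′ ∗ ≈ V ′ ∗ ′ ∗ ′ ∗
  range-2 U =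
    (λ w → T-ext (λ f → from □′-spec λ v r → up v (to □′-spec f v r))
                 (λ f → from □′-spec λ v r → down v (to □′-spec f v r))) ,
    (λ w → T-ext (from T-notnot ∘ up w ∘ to T-notnot)
                 (from T-notnot ∘ down w ∘ to T-notnot))
    where
    □′ : (Fin n → Bool) → Fin n → Bool
    □′ p = □ (not ∘ not ∘ p)

    □′-spec : ∀ {p w} → T (□′ p w) ⇔ (∀ v → R w v → T (p v))
    □′-spec = mk⇔ (λ f v r → to T-notnot (to □-spec f v r))
                  (λ f → from □-spec λ v r → from T-notnot (f v r))

    p = lo (U ⊓ U ′ ∗)

    down : ∀ w → T (□′ (□′ p) w) → T (□′ p w)
    down w f = to □′-spec f w R-refl

    up : ∀ w → T (□′ p w) → T (□′ (□′ p) w)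
    up w f = from □′-spec λ v _ → from □′-spec λ u _ →
      from T-∧ (everywhere u , from □′-spec λ t _ → everywhere t)
      where
      everywhere : ∀ v → T (lo U v)
      everywhere v = to T-notnot
        (□□⇒all (λ u r → proj₂ (to (T-∧ {lo U u}) (to □′-spec f u r))) v)

  complexAlgebra : K₂ 0ℓ 0ℓ
  complexAlgebra = record
    { raw  = raw
    ; isK₂ = record
      { isPseudocomplementedDeMorgan = record
        { isDistributiveLattice = isDistributiveLatticeʳʲᵐ (record
          { isLattice = record
            { isEquivalence = record
              { refl  = (λ _ → refl) , (λ _ → refl)
              ; sym   = λ (p , q) → (sym ∘ p) , (sym ∘ q)
              ; trans = λ (p , q) (r , s) →
                  (λ w → trans (p w) (r w)) , (λ w → trans (q w) (s w))
              }
            ; ∨-comm  = λ U _ → (λ w → ∨-comm (lo U w) _) , (λ w → ∨-comm (hi U w) _)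
            ; ∨-assoc = λ U _ _ → (λ w → ∨-assoc (lo U w) _ _) , (λ w → ∨-assoc (hi U w) _ _)
            ; ∨-cong  = λ (p , q) (r , s) →
                (λ w → cong₂ _∨_ (p w) (r w)) , (λ w → cong₂ _∨_ (q w) (s w))
            ; ∧-comm  = λ U _ → (λ w → ∧-comm (lo U w) _) , (λ w → ∧-comm (hi U w) _)
            ; ∧-assoc = λ U _ _ → (λ w → ∧-assoc (lo U w) _ _) , (λ w → ∧-assoc (hi U w) _ _)
            ; ∧-cong  = λ (p , q) (r , s) →
                (λ w → cong₂ _∧_ (p w) (r w)) , (λ w → cong₂ _∧_ (q w) (s w))
            ; absorptive =
                (λ U _ → (λ w → ∨-abs-∧ (lo U w) _) , (λ w → ∨-abs-∧ (hi U w) _)) ,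
                (λ U _ → (λ w → ∧-abs-∨ (lo U w) _) , (λ w → ∧-abs-∨ (hi U w) _))
            }
          ; ∨-distribʳ-∧ = λ U V _ →
              (λ w → ∨-distribʳ-∧ (lo U w) (lo V w) _) , (λ w → ∨-distribʳ-∧ (hi U w) (hi V w) _)
          })
        ; 0-minimum  = λ _ → (λ _ → refl) , (λ _ → refl)
        ; 1-maximum  = λ _ → (λ _ → sym (∧-identityʳ _)) , (λ _ → sym (∧-identityʳ _))
        ; ∗-disjoint = λ U →
            (λ w → T-disjoint λ p q → to T-not (to □-spec q w R-refl) (lo≤hi U p)) ,
            (λ w → ∧-inverseʳ (hi U w))
        ; ∗-greatest = ∗-greatest
        ; ′-cong       = λ (p , q) → (cong not ∘ q) , (cong not ∘ p)
        ; ′-involutive = λ _ → (λ _ → not-involutive _) , (λ _ → not-involutive _)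
        ; ′-deMorgan   = λ U _ → (λ w → deMorgan₁ (hi U w) _) , (λ w → deMorgan₁ (lo U w) _)
        }
      -- Regularity and the Kleene law hold for the same reason: the left side contains no `lo`
      -- point and the right side contains every `hi` point.
      ; regular = λ U V →
          (λ w → T-≤ (⊥-elim ∘ subst T (regular-lo U w))) ,
          (λ w → T-≤ λ _ → subst T (sym (∨-inverseʳ (hi V w))) tt)
      ; kleene = λ U V →
          (λ w → T-≤ (⊥-elim ∘ subst T (T-disjoint λ p q → to T-not q (lo≤hi U p)))) ,
          (λ w → T-≤ λ _ → excluded-middle (lo≤hi V))
      ; range-2 = range-2
      }
    }
    where
    regular-lo : ∀ U w → lo (U ⊓ U ′ ∗ ′) w ≡ false
    regular-lo U w = T-disjoint {lo U w} λ p q → to T-not (to T-notnot q) p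

    excluded-middle : ∀ {a b} → (T a → T b) → T (b ∨ not a)
    excluded-middle {false} {false} _ = tt
    excluded-middle {a}     {true}  _ = tt
    excluded-middle {true}  {false} f = f tt

-- The complement of a path, with a hub.

infix 4 _↝_ _↝?_

-- The path edges. The condition `0 < i` keeps 0 off the path, which makes it the hub of the
-- complement.
_↝_ : Rel ℕ 0ℓ
i ↝ j = 0 < i × suc i ≡ j

_↝?_ : Decidable _↝_
i ↝? j = (0 <? i) ×-dec (suc i ≟ j)

Adjacent : Rel ℕ 0ℓ
Adjacent i j = ¬ (i ↝ j ⊎ j ↝ i)

module CoPath (n : ℕ) where

  hub-adjacent : ∀ {i} → Adjacent 0 i
  hub-adjacent (inj₁ (() , _))
  hub-adjacent (inj₂ (_ , ()))

  Adjacent-sym : Symmetric Adjacent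
  Adjacent-sym a = a ∘ [ inj₂ , inj₁ ]′

  open ComplexAlgebra {suc n} (Adjacent on toℕ)
    (λ u v → ¬? ((toℕ u ↝? toℕ v) ⊎-dec (toℕ v ↝? toℕ u)))
    [ 1+n≢n ∘ proj₂ , 1+n≢n ∘ proj₂ ]′
    Adjacent-sym
    (λ u w → zero , Adjacent-sym {0} hub-adjacent , hub-adjacent)
    public

-- Terms for the singletons, and their pairwise inequality.

private
  module F = FreeAlgebra (Fin 1)

-- The hi part of t ∗ ′ ∗ consists of the vertices with no neighbour in that of t.
singleton : ℕ → F.Term
singleton zero          = F.0#
singleton (suc zero)    = F.var zero F.′ F.∗
singleton (suc (suc k)) = singleton (suc k) F.∗ F.′ F.∗ F.∧ singleton k F.∗

module _ (n : ℕ) where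
  open CoPath n

  ⟦singleton_⟧ : ℕ → Upset
  ⟦singleton k ⟧ =
    -- The generator has {1} as its `lo` part, which `′ ∗` turns into a `hi` part; its own `hi` part
    -- is full, so that it is an up-set.
    ⟦ complexAlgebra ⟧ (λ _ → mk (λ w → ⌊ toℕ w ≟ 1 ⌋) (const true) λ _ _ → tt) (singleton k)

  -- The guard `0 < k` makes index 0 stand for the empty set rather than for the hub.
  SingletonSpec : ℕ → Set
  SingletonSpec k = ∀ w → T (hi ⟦singleton k ⟧ w) ⇔ (0 < k × toℕ w ≡ k)

  -- The vertices with no neighbour in {k + 1} are its neighbours on the path, and the second
  -- conjunct of the term removes k. The bound ensures that k + 1 is a vertex.
  ∈-singleton-step : ∀ {k} → suc k ≤ n → SingletonSpec k → SingletonSpec (suc k) →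
                     SingletonSpec (suc (suc k))
  ∈-singleton-step {k} k+1≤n ∈-k ∈-k+1 w = mk⇔ ⇒ ⇐
    where
    v = fromℕ< (s≤s k+1≤n)

    v≡k+1 : toℕ v ≡ suc k
    v≡k+1 = toℕ-fromℕ< (s≤s k+1≤n)

    ⇒ : T (hi ⟦singleton suc (suc k) ⟧ w) → 0 < suc (suc k) × toℕ w ≡ suc (suc k)
    ⇒ p with to T-∧ p
    -- Adjacency is a negation, so refuting it yields a path edge only through decidability.
    ... | q , w∉k with decidable-stable ((toℕ w ↝? toℕ v) ⊎-dec (toℕ v ↝? toℕ w))
                         (λ w~v → to T-not (to □-spec (to T-notnot q) v w~v)
                                             (from (∈-k+1 v) (z<s , v≡k+1)))
    -- The `0 < w` of the edge becomes the guard `0 < k` of `∈-k`, which also covers k = 0.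
    ... | inj₁ (0<w , w+1≡v) = ⊥-elim (to T-not w∉k (from (∈-k w) (subst (0 <_) w≡k 0<w , w≡k)))
      where w≡k = suc-injective (trans w+1≡v v≡k+1)
    ... | inj₂ (_ , v+1≡w) = z<s , trans (sym v+1≡w) (cong suc v≡k+1)

    ⇐ : 0 < suc (suc k) × toℕ w ≡ suc (suc k) → T (hi ⟦singleton suc (suc k) ⟧ w)
    ⇐ (_ , w≡k+2) = from T-∧
      ( from T-notnot (from □-spec λ u w~u → from T-not λ u∈ →
          let u≡k+1 = proj₂ (to (∈-k+1 u) u∈) in
          w~u (inj₂ (subst (0 <_) (sym u≡k+1) z<s , trans (cong suc u≡k+1) (sym w≡k+2))))
      , from T-not λ w∈ → case trans (sym w≡k+2) (proj₂ (to (∈-k w) w∈)) of λ ())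

  ∈-singleton : ∀ k → k ≤ n → SingletonSpec k
  ∈-singleton zero _ w = mk⇔ (λ ()) (λ ())
  ∈-singleton (suc zero) _ w =
    mk⇔ (λ p → z<s , toWitness (to T-notnot p))
        (λ (_ , eq) → from T-notnot (fromWitness eq))
  ∈-singleton (suc (suc k)) k+2≤n =
    ∈-singleton-step k+1≤n (∈-singleton k (m+n≤o⇒n≤o 1 k+1≤n)) (∈-singleton (suc k) k+1≤n)
    where k+1≤n = m+n≤o⇒n≤o 1 k+2≤n

-- By soundness, an equality derivable in the free algebra holds in the algebra of a path long
-- enough to contain both i + 1 and j + 1, where the vertex i + 1 then lies in both singletons.
singleton-injective : ∀ {i j} → singleton (suc i) F.≈ singleton (suc j) → i ≡ j
singleton-injective {i} {j} eq = suc-injective (trans (sym w≡1+i) w≡1+j)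
  where
  n = suc (i + j)
  open CoPath n

  1+i≤n : suc i ≤ n
  1+i≤n = s≤s (m≤m+n i j)

  w = fromℕ< (s≤s 1+i≤n)

  w≡1+i : toℕ w ≡ suc i
  w≡1+i = toℕ-fromℕ< (s≤s 1+i≤n)

  w≡1+j : toℕ w ≡ suc j
  w≡1+j = proj₂ (to (∈-singleton n (suc j) (s≤s (m≤n+m j i)) w)
    (subst T (hi-≡ (⟦⟧-cong complexAlgebra _ eq) w)
      (from (∈-singleton n (suc i) 1+i≤n w) (z<s , w≡1+i))))

-- Local finiteness concerns generated subuniverses; this places the singleton terms in the one
-- generated by the variable.
generated : ∀ {x} {X : Set x} (t : FreeAlgebra.Term X) →
            Sg (K₂.raw (Free X)) FreeAlgebra.var t
generated (FreeAlgebra.var i) = gen i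
generated (s FreeAlgebra.∧ t) = ∧-closed (generated s) (generated t)
generated (s FreeAlgebra.∨ t) = ∨-closed (generated s) (generated t)
generated (s FreeAlgebra.∗)   = ∗-closed (generated s)
generated (s FreeAlgebra.′)   = ′-closed (generated s)
generated FreeAlgebra.0#      = 0-closed
generated FreeAlgebra.1#      = 1-closed

theorem4p14 : (¬ LocallyFinite-K₂ 0ℓ 0ℓ) × Infinite (K₂.setoid (Free (Fin 1)))
theorem4p14 = ¬locally-finite , record
  { to        = singleton ∘ suc
  ; cong      = λ { refl → F.refl }
  ; injective = singleton-injective
  }
  where
  ¬locally-finite : ¬ LocallyFinite-K₂ 0ℓ 0ℓ
  ¬locally-finite locally-finite =
    infinite⇒¬finite (SgSetoid (Free (Fin 1)) F.var)
      (record
        { to        = λ i → singleton (suc i) , generated (singleton (suc i))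
        ; cong      = λ { refl → F.refl }
        ; injective = singleton-injective
        })
      (locally-finite (Free (Fin 1)) 1 F.var)
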